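{- Let $a, b$ be nonnegative integers with $a \ge 1$, and let $G$ be a finite simple graph. If $\mathrm{mad}(G) < \frac{4}{3}a + b$, then $G$ is $(1_1, 1_2, \ldots, 1_a, 0_1, \ldots, 0_b)$-colorable.
   Context: For nonnegative integers $a,b,d$, a graph $G$ is $(d_1, \ldots, d_a, 0_1, \ldots, 0_b)$-colorable if $V(G)$ can be partitioned into $b$ independent sets $O_1,\ldots,O_b$ and $a$ sets $D_1,\ldots,D_a$ such that each induced subgraph $G[D_i]$ has maximum degree at most $d$. The maximum average degree $\mathrm{mad}(G)$ is the maximum, over all subgraphs $H$ of $G$, of the average degree $2|E(H)|/|V(H)|$. -}

module Defs where

open import Data.Nat using (ℕ; _+_; _*_; _≤_; _<_)
open import Data.Bool using (Bool; true; false; _∧_; if_then_else_)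
open import Data.Fin using (Fin)
open import Data.List using (List; map)
open import Data.Nat.ListAction using (sum)
open import Data.List using () renaming (allFin to allFinL)
open import Data.Sum using (_⊎_; inj₁; inj₂)
open import Data.Product using (Σ; _×_)
open import Data.Sum.Properties using (≡-dec)
open import Data.Fin.Properties using (_≟_)
open import Relation.Nullary using (¬_)
open import Relation.Nullary.Decidable using (⌊_⌋)
open import Relation.Binary.PropositionalEquality using (_≡_)

record Graph : Set where
  field
    n     : ℕ
    adj   : Fin n → Fin n → Bool
    sym   : ∀ u v → adj u v ≡ adj v u
    irrefl : ∀ v → adj v v ≡ false
open Graph public

count : (m : ℕ) → (Fin m → Bool) → ℕ
count m p = sum (map (λ x → if p x then 1 else 0) (allFinL m))

record Subgraph (G : Graph) : Set where
  field
    vert  : Fin (n G) → Bool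
    edge  : Fin (n G) → Fin (n G) → Bool
    esym  : ∀ u v → edge u v ≡ edge v u
    eadj  : ∀ u v → edge u v ≡ true → adj G u v ≡ true
    evert : ∀ u v → edge u v ≡ true → vert u ≡ true
open Subgraph public

nV : {G : Graph} → Subgraph G → ℕ
nV {G} H = count (n G) (vert H)

twoE : {G : Graph} → Subgraph G → ℕ
twoE {G} H = sum (map (λ u → count (n G) (edge H u)) (allFinL (n G)))

-- mad(G) < p / q  (q > 0 assumed by use): every nonempty subgraph H has
-- 2|E(H)| / |V(H)| < p / q, i.e. q · 2|E(H)| < p · |V(H)|.
-- (For the empty graph mad = 0 by convention, matching vacuity.)
madLess : Graph → ℕ → ℕ → Set
madLess G p q = (H : Subgraph G) → 1 ≤ nV H → q * twoE H < p * nV H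

-- (1_1,…,1_a, 0_1,…,0_b)-colorable: a map c : V → Fin a ⊎ Fin b, where
-- c v = inj₁ i means v ∈ D_i and c v = inj₂ j means v ∈ O_j; each O_j is
-- independent and each G[D_i] has maximum degree at most 1.
Colorable11-00 : (a b : ℕ) → Graph → Set
Colorable11-00 a b G =
  Σ (Fin (n G) → Fin a ⊎ Fin b) λ c →
    (∀ u v (j : Fin b) → c u ≡ inj₂ j → c v ≡ inj₂ j → adj G u v ≡ false)
    × (∀ u (i : Fin a) → c u ≡ inj₁ i →
         count (n G) (λ v → adj G u v ∧ ⌊ ≡-dec _≟_ _≟_ (c v) (inj₁ i) ⌋) ≤ 1)

{-# OPTIONS --safe #-}
-- Induct on the coloured vertex set S.  For every v ∈ S take a proper colouring c_v of S - v,
-- and let F v be its number of monochromatic (ordered) adjacent pairs; choose the family with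
-- Σ F minimal.  If S is not colourable, every v has a neighbour of every colour under c_v.
-- Suppose w is the only neighbour of v of its colour k.  Then giving v colour k and uncolouring w
-- colours S - w, and if k is a D-colour, w already has a neighbour of colour k (otherwise colour
-- v by k), so the swap destroys a monochromatic edge.  Minimality gives F w ≤ F v, strictly so
-- for a D-colour.  Let each v claim 1 from such w of D-colour: then v lies, under c_w, in a class in
-- which w has at least two neighbours.  A class in which v has s neighbours thus contributes
-- to 3 deg v + claimed - paid at least 3s + 1 ≥ 4 (D, s = 1), 3s ≥ 3 (O, s = 1) or 2s ≥ 4 (s ≥ 2).
-- Summing, 3 Σ deg ≥ (4a + 3b) |S|, contrary to the density hypothesis.

module Submission where

open import Defs
open import Data.Nat using (ℕ; _≤_; _+_; _*_)

import Algebra.Properties.Semiring.Sum as Sum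
open import Data.Bool using (true; false; if_then_else_; _∧_)
import Data.Bool.Properties as Bool
open import Data.Fin using (Fin; zero; suc; fromℕ<)
open import Data.Fin.Properties using (_≟_; sequence)
open import Data.Fin.Subset using (Subset; inside; outside; _∈_; _∉_; _-_; _⊂_; ⁅_⁆; ⊤; Nonempty)
open import Data.Fin.Subset.Induction using (⊂-wellFounded)
open import Data.Fin.Subset.Properties
  using (_∈?_; ∈⊤; p─q⊆p; x∈p∧x≢y⇒x∈p-y; x∈p⇒p-x⊂p; nonempty?)
open import Data.List using (map; tabulate; allFin)
open import Data.List.Properties using (map-tabulate)
open import Data.Nat using (zero; suc; _<_; z≤n; s≤s; _≤?_; _<?_)
import Data.Nat as ℕ
open import Data.Nat.Induction using (<-wellFounded)
import Data.Nat.ListAction as List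
open import Data.Nat.Properties hiding (_≟_; _≤?_; _<?_)
open import Data.Nat.Tactic.RingSolver using (solve-∀)
open import Data.Product using (∃; _×_; _,_; proj₁; proj₂)
open import Data.Sum using (_⊎_; inj₁; inj₂; [_,_]; [_,_]′)
import Data.Sum.Effectful.Left as Left
open import Data.Sum.Properties using (≡-dec)
open import Data.Vec using (_∷_; there)
open import Data.Vec.Functional using (updateAt)
open import Data.Vec.Functional.Properties using (updateAt-updates; updateAt-minimal)
open import Function using (_∘_; const; id; mk⇔)
open import Induction.WellFounded using (Acc; acc)
open import Level using (0ℓ)
open import Relation.Binary.Definitions using (DecidableEquality)
open import Relation.Binary.PropositionalEquality as ≡
  using (_≡_; _≢_; refl; cong; cong₂; subst; subst₂)
open import Relation.Nullary using (¬_; Dec; yes; no; contradiction)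
open import Relation.Nullary.Decidable using (⌊_⌋; _×-dec_; isYes≗does; does-⇔; dec-true)
open import Relation.Unary using (Pred; Decidable)

open Sum +-*-semiring using (sum-cong-≗; ∑-distrib-+; ∑-comm; *-distribʳ-sum) renaming (sum to ∑)

private variable
  m : ℕ
  P : Set

-- Finite sums of natural numbers.

∑-mono : (f g : Fin m → ℕ) → (∀ i → f i ≤ g i) → ∑ f ≤ ∑ g
∑-mono {zero}  f g f≤g = z≤n
∑-mono {suc m} f g f≤g = +-mono-≤ (f≤g zero) (∑-mono (f ∘ suc) (g ∘ suc) (f≤g ∘ suc))

-- A change at a single index is recorded additively, since subtraction on `ℕ` truncates: `d = 1`,
-- `e = 0` makes an inequality of sums strict, and `d = 0`, `e = 1` allows a loss of one.
∑-mono-at : (f g : Fin m → ℕ) (j : Fin m) (d e : ℕ) →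
            (∀ i → i ≢ j → f i ≤ g i) → f j + d ≤ g j + e → ∑ f + d ≤ ∑ g + e
∑-mono-at {suc m} f g zero d e f≤g fj≤gj = begin
  f zero + ∑ (f ∘ suc) + d    ≡⟨ exchange (f zero) _ d ⟩
  f zero + d + ∑ (f ∘ suc)    ≤⟨ +-mono-≤ fj≤gj (∑-mono (f ∘ suc) (g ∘ suc) λ i → f≤g (suc i) λ ()) ⟩
  g zero + e + ∑ (g ∘ suc)    ≡⟨ exchange (g zero) e _ ⟩
  g zero + ∑ (g ∘ suc) + e    ∎
  where
  open ≤-Reasoning
  exchange : ∀ x y z → x + y + z ≡ x + z + y
  exchange = solve-∀
∑-mono-at {suc m} f g (suc j) d e f≤g fj≤gj = begin
  f zero + ∑ (f ∘ suc) + d    ≡⟨ +-assoc (f zero) _ d ⟩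
  f zero + (∑ (f ∘ suc) + d)  ≤⟨ +-mono-≤ (f≤g zero λ ())
    (∑-mono-at (f ∘ suc) (g ∘ suc) j d e (λ i i≢j → f≤g (suc i) λ { refl → i≢j refl }) fj≤gj) ⟩
  g zero + (∑ (g ∘ suc) + e)  ≡⟨ +-assoc (g zero) _ e ⟨
  g zero + ∑ (g ∘ suc) + e    ∎
  where open ≤-Reasoning

∑-const : ∀ m x → ∑ {m} (λ _ → x) ≡ m * x
∑-const zero    x = refl
∑-const (suc m) x = cong (x +_) (∑-const m x)

∑-zero : (f : Fin m → ℕ) → (∀ i → f i ≡ 0) → ∑ f ≡ 0
∑-zero {m} f f≡0 = ≡.trans (sum-cong-≗ f≡0) (≡.trans (∑-const m 0) (*-zeroʳ m))

∑-single : (f : Fin m → ℕ) (j : Fin m) → (∀ i → i ≢ j → f i ≡ 0) → ∑ f ≡ f j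
∑-single f zero    f≡0 =
  ≡.trans (cong (f zero +_) (∑-zero (f ∘ suc) λ i → f≡0 (suc i) λ ())) (+-identityʳ _)
∑-single f (suc j) f≡0 =
  cong₂ _+_ (f≡0 zero λ ()) (∑-single (f ∘ suc) j λ i i≢j → f≡0 (suc i) λ { refl → i≢j refl })

sum-allFin : (f : Fin m → ℕ) → List.sum (map f (allFin m)) ≡ ∑ f
sum-allFin f = ≡.trans (cong List.sum (map-tabulate id f)) (sum-tabulate f)
  where
  sum-tabulate : ∀ {m} (f : Fin m → ℕ) → List.sum (tabulate f) ≡ ∑ f
  sum-tabulate {zero}  f = refl
  sum-tabulate {suc m} f = cong (f zero +_) (sum-tabulate (f ∘ suc))

-- Indicators and counting.

-- Has the shape of the summand of `count`, so that the counts in the hypothesis unfold to sums of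
-- indicators.
𝟙 : Dec P → ℕ
𝟙 P? = if ⌊ P? ⌋ then 1 else 0

𝟙-yes : (P? : Dec P) → P → 𝟙 P? ≡ 1
𝟙-yes (yes _) p = refl
𝟙-yes (no ¬p) p = contradiction p ¬p

𝟙-no : (P? : Dec P) → ¬ P → 𝟙 P? ≡ 0
𝟙-no (yes p) ¬p = contradiction p ¬p
𝟙-no (no _)  ¬p = refl

𝟙≤1 : (P? : Dec P) → 𝟙 P? ≤ 1
𝟙≤1 (yes _) = ≤-refl
𝟙≤1 (no _)  = z≤n

if≤𝟙 : ∀ t (P? : Dec P) → (t ≡ true → P) → (if t then 1 else 0) ≤ 𝟙 P?
if≤𝟙 false P? t⇒P = z≤n
if≤𝟙 true  P? t⇒P = ≤-reflexive (≡.sym (𝟙-yes P? (t⇒P refl)))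

isYes⇒ : (P? : Dec P) → ⌊ P? ⌋ ≡ true → P
isYes⇒ (yes p) _ = p

⇒isYes : (P? : Dec P) → P → ⌊ P? ⌋ ≡ true
⇒isYes P? p = ≡.trans (isYes≗does P?) (dec-true P? p)

# : {P : Pred (Fin m) 0ℓ} → Decidable P → ℕ
# P? = ∑ (λ x → 𝟙 (P? x))

module _ {P : Pred (Fin m) 0ℓ} (P? : Decidable P) where

  #-mono : {Q : Pred (Fin m) 0ℓ} (Q? : Decidable Q) → (∀ x → P x → Q x) → # P? ≤ # Q?
  #-mono Q? P⇒Q = ∑-mono _ _ λ x → if≤𝟙 _ (Q? x) (P⇒Q x ∘ isYes⇒ (P? x))

  #-none : (∀ x → ¬ P x) → # P? ≡ 0
  #-none ¬P = ∑-zero _ λ x → 𝟙-no (P? x) (¬P x)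

  #-some : ∀ {x} → P x → 1 ≤ # P?
  #-some {x} Px = begin
    1                      ≤⟨ m≤n+m 1 _ ⟩
    ∑ {m} (λ _ → 0) + 1    ≤⟨ ∑-mono-at _ _ x 1 0 (λ _ _ → z≤n)
                                (≤-reflexive (≡.sym (≡.trans (+-identityʳ _) (𝟙-yes (P? x) Px)))) ⟩
    # P? + 0               ≡⟨ +-identityʳ _ ⟩
    # P?                   ∎
    where open ≤-Reasoning

#-unique : {P : Pred (Fin m) 0ℓ} (P? : Decidable P) → # P? ≤ 1 → ∀ {x y} → P x → P y → x ≡ y
#-unique P? #≤1 {x} {y} Px Py with x ≟ y
... | yes x≡y = x≡y
-- The indicator of `x` alone lies below that of `P` and leaves room for one more at `y`, so two
-- distinct witnesses force a count of 2.
... | no  x≢y = contradiction (begin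
    2                  ≤⟨ +-monoˡ-≤ 1 (#-some (x ≟_) refl) ⟩
    # (x ≟_) + 1       ≤⟨ ∑-mono-at _ _ y 1 0 below at-y ⟩
    # P? + 0           ≡⟨ +-identityʳ _ ⟩
    # P?               ≤⟨ #≤1 ⟩
    1                  ∎) λ { (s≤s ()) }
  where
  open ≤-Reasoning
  below : ∀ i → i ≢ y → 𝟙 (x ≟ i) ≤ 𝟙 (P? i)
  below i _ = if≤𝟙 _ (P? i) λ e → subst _ (isYes⇒ (x ≟ i) e) Px
  at-y : 𝟙 (x ≟ y) + 1 ≤ 𝟙 (P? y) + 0
  at-y rewrite 𝟙-no (x ≟ y) x≢y | 𝟙-yes (P? y) Py = ≤-refl

-- Deleting a vertex, and finite case search.

x∉p-x : (p : Subset m) (x : Fin m) → x ∉ p - x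
x∉p-x (inside  ∷ p) zero    ()
x∉p-x (outside ∷ p) zero    ()
x∉p-x (inside  ∷ p) (suc x) (there x∈) = x∉p-x p x x∈
x∉p-x (outside ∷ p) (suc x) (there x∈) = x∉p-x p x x∈

x∈p-y⇒x∈p : {p : Subset m} {x y : Fin m} → x ∈ p - y → x ∈ p
x∈p-y⇒x∈p {p = p} {y = y} = p─q⊆p p ⁅ y ⁆

x∈p-y⇒x≢y : {p : Subset m} {x y : Fin m} → x ∈ p - y → x ≢ y
x∈p-y⇒x≢y {p = p} x∈p-x refl = x∉p-x p _ x∈p-x

-- Finite search in the exception applicative: an index that yields `X` ends it, otherwise the
-- values of `P` are collected. No decision procedure for `P` is involved.
everywhere : {X : Set} {P : Pred (Fin m) 0ℓ} → (∀ i → X ⊎ P i) → X ⊎ (∀ i → P i)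
everywhere {X = X} = sequence (Left.applicative X 0ℓ)

-- Colours and sums over them.

module Colouring (a b : ℕ) where

  Colour : Set
  Colour = Fin a ⊎ Fin b

  _≟ᶜ_ : DecidableEquality Colour
  _≟ᶜ_ = ≡-dec _≟_ _≟_

  cap : Colour → ℕ
  cap (inj₁ _) = 1
  cap (inj₂ _) = 0

  cap≤1 : ∀ k → cap k ≤ 1
  cap≤1 (inj₁ _) = ≤-refl
  cap≤1 (inj₂ _) = z≤n

  everywhereᶜ : {X : Set} {P : Pred Colour 0ℓ} → (∀ k → X ⊎ P k) → X ⊎ (∀ k → P k)
  everywhereᶜ f with everywhere (f ∘ inj₁) | everywhere (f ∘ inj₂)
  ... | inj₁ x | _      = inj₁ x
  ... | inj₂ _ | inj₁ x = inj₁ x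
  ... | inj₂ g | inj₂ h = inj₂ [ g , h ]

  ∑ᶜ : (Colour → ℕ) → ℕ
  ∑ᶜ f = ∑ (f ∘ inj₁) + ∑ (f ∘ inj₂)

  ∑ᶜ-mono : (f g : Colour → ℕ) → (∀ k → f k ≤ g k) → ∑ᶜ f ≤ ∑ᶜ g
  ∑ᶜ-mono f g f≤g = +-mono-≤ (∑-mono _ _ (f≤g ∘ inj₁)) (∑-mono _ _ (f≤g ∘ inj₂))

  ∑ᶜ-cong : (f g : Colour → ℕ) → (∀ k → f k ≡ g k) → ∑ᶜ f ≡ ∑ᶜ g
  ∑ᶜ-cong f g f≡g = cong₂ _+_ (sum-cong-≗ (f≡g ∘ inj₁)) (sum-cong-≗ (f≡g ∘ inj₂))

  ∑ᶜ-distrib-+ : (f g : Colour → ℕ) → ∑ᶜ (λ k → f k + g k) ≡ ∑ᶜ f + ∑ᶜ g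
  ∑ᶜ-distrib-+ f g = ≡.trans
    (cong₂ _+_ (∑-distrib-+ (f ∘ inj₁) (g ∘ inj₁)) (∑-distrib-+ (f ∘ inj₂) (g ∘ inj₂)))
    (interchange (∑ (f ∘ inj₁)) _ _ _)
    where
    interchange : ∀ x y z t → x + y + (z + t) ≡ x + z + (y + t)
    interchange = solve-∀

  ∑ᶜ-∑-comm : (f : Fin m → Colour → ℕ) → ∑ (λ u → ∑ᶜ (f u)) ≡ ∑ᶜ (λ k → ∑ (λ u → f u k))
  ∑ᶜ-∑-comm f = ≡.trans (∑-distrib-+ (λ u → ∑ (f u ∘ inj₁)) (λ u → ∑ (f u ∘ inj₂)))
    (cong₂ _+_ (∑-comm (λ u → f u ∘ inj₁)) (∑-comm (λ u → f u ∘ inj₂)))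

  ∑ᶜ-single : (f : Colour → ℕ) (k : Colour) → (∀ l → l ≢ k → f l ≡ 0) → ∑ᶜ f ≡ f k
  ∑ᶜ-single f (inj₁ i) f≡0 = ≡.trans
    (cong₂ _+_ (∑-single _ i λ j j≢i → f≡0 (inj₁ j) λ { refl → j≢i refl })
               (∑-zero _ λ j → f≡0 (inj₂ j) λ ()))
    (+-identityʳ _)
  ∑ᶜ-single f (inj₂ i) f≡0 =
    cong₂ _+_ (∑-zero _ λ j → f≡0 (inj₁ j) λ ())
              (∑-single _ i λ j j≢i → f≡0 (inj₂ j) λ { refl → j≢i refl })

  -- Each `u` has exactly one colour, so inserting a sum over `k` adds only zero terms; then the two
  -- sums are exchanged. The inner count on the right has the form of `nbrs`.
  ∑-by-colour : {A : Pred (Fin m) 0ℓ} (A? : Decidable A) (c : Fin m → Colour) (h : Colour → ℕ) →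
                ∑ (λ u → 𝟙 (A? u) * h (c u)) ≡ ∑ᶜ (λ k → # (λ u → A? u ×-dec k ≟ᶜ c u) * h k)
  ∑-by-colour A? c h = ≡.trans (sum-cong-≗ (≡.sym ∘ at)) (≡.trans
    (∑ᶜ-∑-comm (λ u k → 𝟙 (A? u ×-dec k ≟ᶜ c u) * h k))
    (∑ᶜ-cong _ _ λ k → ≡.sym (*-distribʳ-sum (h k) λ u → 𝟙 (A? u ×-dec k ≟ᶜ c u))))
    where
    here-𝟙 : ∀ u → 𝟙 (A? u ×-dec c u ≟ᶜ c u) ≡ 𝟙 (A? u)
    here-𝟙 u with A? u
    ... | yes p = 𝟙-yes (yes p ×-dec c u ≟ᶜ c u) (p , refl)
    ... | no ¬p = refl
    at : ∀ u → ∑ᶜ (λ k → 𝟙 (A? u ×-dec k ≟ᶜ c u) * h k) ≡ 𝟙 (A? u) * h (c u)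
    at u = ≡.trans
      (∑ᶜ-single _ (c u) λ k k≢ → cong (_* h k) (𝟙-no (A? u ×-dec k ≟ᶜ c u) (k≢ ∘ proj₂)))
      (cong (_* h (c u)) (here-𝟙 u))

  -- Colourings of induced subgraphs and recolouring one vertex.

  module _ (G : Graph) where

    private
      V : Set
      V = Fin (n G)
      variable
        S : Subset (n G)
        c : V → Colour
        u v w : V
        k : Colour

    -- Adjacency in the subgraph induced by `S`. Deleting a vertex changes only `S`, so colourings
    -- keep one type throughout the induction.
    Adj : Subset (n G) → V → V → Set
    Adj S u v = u ∈ S × v ∈ S × adj G u v ≡ true

    adj? : ∀ S u v → Dec (Adj S u v)
    adj? S u v = u ∈? S ×-dec v ∈? S ×-dec adj G u v Bool.≟ true

    Adj-sym : Adj S u v → Adj S v u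
    Adj-sym {u = u} {v} (u∈S , v∈S , uv) = v∈S , u∈S , ≡.trans (Graph.sym G v u) uv

    Adj⇒≢ : Adj S u v → u ≢ v
    Adj⇒≢ {u = u} (_ , _ , uu) refl with () ← ≡.trans (≡.sym uu) (irrefl G u)

    Adj-mono : Adj (S - w) u v → Adj S u v
    Adj-mono (u∈ , v∈ , uv) = x∈p-y⇒x∈p u∈ , x∈p-y⇒x∈p v∈ , uv

    Adj-remove : Adj S u v → u ≢ w → v ≢ w → Adj (S - w) u v
    Adj-remove (u∈ , v∈ , uv) u≢w v≢w = x∈p∧x≢y⇒x∈p-y u∈ u≢w , x∈p∧x≢y⇒x∈p-y v∈ v≢w , uv

    nbr? : ∀ S (c : V → Colour) u k v → Dec (Adj S u v × k ≡ c v)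
    nbr? S c u k v = adj? S u v ×-dec k ≟ᶜ c v

    nbrs : Subset (n G) → (V → Colour) → V → Colour → ℕ
    nbrs S c u k = # (nbr? S c u k)

    -- Zero when u ∉ S, so that a colouring of S is a total function whose values off S are junk.
    mono : Subset (n G) → (V → Colour) → V → ℕ
    mono S c u = nbrs S c u (c u)

    totalMono : Subset (n G) → (V → Colour) → ℕ
    totalMono S c = ∑ (mono S c)

    Proper : Subset (n G) → (V → Colour) → Set
    Proper S c = ∀ u → mono S c u ≤ cap (c u)

    Colourable : Subset (n G) → Set
    Colourable S = ∃ (Proper S)

    recolour : (V → Colour) → V → Colour → V → Colour
    recolour c v k = updateAt c v (const k)

    recolour-at : ∀ c v k → recolour c v k v ≡ k
    recolour-at c v k = updateAt-updates v c

    recolour-off : ∀ c k → u ≢ v → recolour c v k u ≡ c u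
    recolour-off {u} {v} c k u≢v = updateAt-minimal u v c u≢v

    -- Only `v` and its neighbours of colour `k` see a new monochromatic edge: the first has few
    -- enough by assumption, and each of the others has room for one more.
    extend : Proper (S - v) c → nbrs S c v k ≤ cap k →
             (∀ u → Adj S v u → k ≡ c u → mono (S - v) c u < cap k) → Colourable S
    extend {S} {v} {c} {k} proper few unsaturated = c′ , proper′
      where
      c′ = recolour c v k
      open ≤-Reasoning
      proper′ : Proper S c′
      proper′ u with u ≟ v
      -- The junk value `c v` does not affect the count at `v`, as `v` is not its own neighbour.
      ... | yes refl rewrite recolour-at c u k =
        ≤-trans (#-mono (nbr? S c′ u k) (nbr? S c u k)
          λ x (ux , e) → ux , ≡.trans e (recolour-off c k (Adj⇒≢ ux ∘ ≡.sym))) few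
      ... | no u≢v rewrite recolour-off c k u≢v with nbr? S c v k u
      ...   | yes (vu , k≡cu) = begin
        nbrs S c′ u (c u)        ≡⟨ +-identityʳ _ ⟨
        nbrs S c′ u (c u) + 0    ≤⟨ ∑-mono-at _ _ v 0 1 off-v at-v ⟩
        mono (S - v) c u + 1     ≡⟨ +-comm _ 1 ⟩
        suc (mono (S - v) c u)   ≤⟨ unsaturated u vu k≡cu ⟩
        cap k                    ≡⟨ cong cap k≡cu ⟩
        cap (c u)                ∎
        where
        -- The recoloured `v` is the one possible new neighbour of `u` in its own class.
        at-v : 𝟙 (nbr? S c′ u (c u) v) + 0 ≤ 𝟙 (nbr? (S - v) c u (c u) v) + 1
        at-v = ≤-trans (≤-reflexive (+-identityʳ _)) (≤-trans (𝟙≤1 (nbr? S c′ u (c u) v)) (m≤n+m 1 _))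
        off-v : ∀ x → x ≢ v → 𝟙 (nbr? S c′ u (c u) x) ≤ 𝟙 (nbr? (S - v) c u (c u) x)
        off-v x x≢v = if≤𝟙 _ (nbr? (S - v) c u (c u) x) λ t →
          let (ux , e) = isYes⇒ (nbr? S c′ u (c u) x) t
          in Adj-remove ux u≢v x≢v , ≡.trans e (recolour-off c k x≢v)
      ...   | no ¬vu = ≤-trans (#-mono (nbr? S c′ u (c u)) (nbr? (S - v) c u (c u)) keep) (proper u)
        where
        keep : ∀ x → Adj S u x × c u ≡ c′ x → Adj (S - v) u x × c u ≡ c x
        keep x (ux , e) with x ≟ v
        ... | yes refl = contradiction (Adj-sym ux , ≡.sym (≡.trans e (recolour-at c x k))) ¬vu
        ... | no x≢v   = Adj-remove ux u≢v x≢v , ≡.trans e (recolour-off c k x≢v)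

    -- Passing from a colouring of S - v to one of S - w: w keeps its colour as a junk value.
    module _ (proper : Proper (S - v) c) (vw : Adj S v w) (unique : nbrs S c v (c w) ≡ 1) where

      private
        c′ : V → Colour
        c′ = recolour c v (c w)

        -- The only neighbour of `v` with its new colour was `w`, which is now uncoloured.
        isolated : ∀ {x} → Adj (S - w) v x → c′ v ≢ c′ x
        isolated {x} vx e = x∈p-y⇒x≢y (proj₁ (proj₂ vx))
          (#-unique (nbr? S c v (c w)) (≤-reflexive unique)
            (Adj-mono vx , (begin
              c w    ≡⟨ recolour-at c v (c w) ⟨
              c′ v   ≡⟨ e ⟩
              c′ x   ≡⟨ recolour-off c (c w) (Adj⇒≢ vx ∘ ≡.sym) ⟩
              c x    ∎))
            (vw , refl))
          where open ≡.≡-Reasoning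

        old : ∀ u x → Adj (S - w) u x × c′ u ≡ c′ x → Adj (S - v) u x × c u ≡ c x
        old u x (ux , e) with u ≟ v | x ≟ v
        ... | yes refl | _        = contradiction e (isolated ux)
        ... | no _     | yes refl = contradiction (≡.sym e) (isolated (Adj-sym ux))
        ... | no u≢v   | no x≢v   = Adj-remove (Adj-mono ux) u≢v x≢v ,
          ≡.trans (≡.sym (recolour-off c _ u≢v)) (≡.trans e (recolour-off c _ x≢v))

        mono-≤ : ∀ u → mono (S - w) c′ u ≤ mono (S - v) c u
        mono-≤ u = #-mono (nbr? (S - w) c′ u (c′ u)) (nbr? (S - v) c u (c u)) (old u)

      swap-Proper : Proper (S - w) c′
      swap-Proper u with u ≟ v
      ... | yes refl = ≤-trans (≤-reflexive (#-none (nbr? (S - w) c′ v (c′ v)) λ x (vx , e) → isolated vx e)) z≤n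
      ... | no u≢v   = ≤-trans (mono-≤ u)
        (≤-trans (proper u) (≤-reflexive (cong cap (≡.sym (recolour-off c _ u≢v)))))

      -- No vertex gains a monochromatic neighbour, and the term of `w`, at least `cap (c w)`
      -- before, becomes 0 because `w` has left the vertex set.
      swap-totalMono : cap (c w) ≤ mono (S - v) c w →
                       totalMono (S - w) c′ + cap (c w) ≤ totalMono (S - v) c
      swap-totalMono saturated = begin
        totalMono (S - w) c′ + cap (c w)  ≤⟨ ∑-mono-at _ _ w (cap (c w)) 0 (λ u _ → mono-≤ u) at-w ⟩
        totalMono (S - v) c + 0           ≡⟨ +-identityʳ _ ⟩
        totalMono (S - v) c               ∎
        where
        open ≤-Reasoning
        at-w : mono (S - w) c′ w + cap (c w) ≤ mono (S - v) c w + 0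
        at-w rewrite #-none (nbr? (S - w) c′ w (c′ w)) (λ x (wx , _) → x∉p-x S w (proj₁ wx)) =
          ≤-trans saturated (m≤m+n _ 0)

    -- Discharging: v claims 1 from w when w is its only neighbour in some D_i, and w pays at most
    -- 1 per edge, only to classes in which it has at least two neighbours.
    weight : Colour → ℕ
    weight (inj₁ _) = 4
    weight (inj₂ _) = 3

    claim : Colour → ℕ → ℕ
    claim (inj₁ _) 1 = 1
    claim _        _ = 0

    payment : ℕ → ℕ
    payment (suc (suc _)) = 1
    payment _             = 0

    -- For `s = 1` both kinds of colour give equality. For `s ≥ 2` nothing is claimed and the
    -- inequality becomes `weight k ≤ 2 * s`.
    weight-balance : ∀ k {s} → 1 ≤ s → weight k + s * payment s ≤ s * (3 + claim k s)
    weight-balance (inj₁ _) {1} _ = ≤-refl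
    weight-balance (inj₂ _) {1} _ = ≤-refl
    weight-balance (inj₁ _) {suc (suc s)} _ = subst (4 + (2 + s) * 1 ≤_) (slack s) (m≤m+n _ (2 * s))
      where
      slack : ∀ s → 4 + (2 + s) * 1 + 2 * s ≡ (2 + s) * 3
      slack = solve-∀
    weight-balance (inj₂ _) {suc (suc s)} _ = subst (3 + (2 + s) * 1 ≤_) (slack s) (m≤m+n _ (1 + 2 * s))
      where
      slack : ∀ s → 3 + (2 + s) * 1 + (1 + 2 * s) ≡ (2 + s) * 3
      slack = solve-∀

    ∑ᶜ-weight : ∑ᶜ weight ≡ 4 * a + 3 * b
    ∑ᶜ-weight = cong₂ _+_ (≡.trans (∑-const a 4) (*-comm a 4)) (≡.trans (∑-const b 3) (*-comm b 3))

    degree : Subset (n G) → V → ℕ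
    degree S v = # (adj? S v)

    -- Families of colourings and descent on the potential.

    module _ (S : Subset (n G)) where

      Family : Set
      Family = V → V → Colour

      ProperFamily : Family → Set
      ProperFamily cs = ∀ v → v ∈ S → Proper (S - v) (cs v)

      potential : Family → ℕ
      potential cs = ∑ (λ v → totalMono (S - v) (cs v))

      Improvable : Family → Set
      Improvable cs = ∃ λ cs′ → ProperFamily cs′ × potential cs′ < potential cs

      -- The consequence of minimality that the discharging uses. Being a decidable condition on
      -- pairs, it can be reached by descent instead of choosing a minimal family.
      Stable : Family → V → V → Set
      Stable cs v w = Adj S v w → nbrs S (cs v) v (cs v w) ≡ 1 →
                      totalMono (S - w) (cs w) + cap (cs v w) ≤ totalMono (S - v) (cs v)

      module _ (cs : Family) (proper : ProperFamily cs) where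

        replace-improves : w ∈ S → Proper (S - w) c →
                           totalMono (S - w) c < totalMono (S - w) (cs w) → Improvable cs
        replace-improves {w} {c} w∈S proper-c less = cs′ , proper′ , smaller
          where
          cs′ : Family
          cs′ = updateAt cs w (const c)
          proper′ : ProperFamily cs′
          proper′ v v∈S with v ≟ w
          ... | yes refl = subst (Proper (S - v)) (≡.sym (updateAt-updates v cs)) proper-c
          ... | no v≢w   = subst (Proper (S - v)) (≡.sym (updateAt-minimal v w cs v≢w)) (proper v v∈S)
          open ≤-Reasoning
          off-w : ∀ v → v ≢ w → totalMono (S - v) (cs′ v) ≤ totalMono (S - v) (cs v)
          off-w v v≢w = ≤-reflexive (cong (totalMono (S - v)) (updateAt-minimal v w cs v≢w))
          at-w : totalMono (S - w) (cs′ w) + 1 ≤ totalMono (S - w) (cs w) + 0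
          at-w = begin
            totalMono (S - w) (cs′ w) + 1  ≡⟨ cong (λ c → totalMono (S - w) c + 1) (updateAt-updates w cs) ⟩
            totalMono (S - w) c + 1        ≡⟨ +-comm _ 1 ⟩
            suc (totalMono (S - w) c)      ≤⟨ less ⟩
            totalMono (S - w) (cs w)       ≡⟨ +-identityʳ _ ⟨
            totalMono (S - w) (cs w) + 0   ∎
          smaller : potential cs′ < potential cs
          smaller = begin
            suc (potential cs′)  ≡⟨ +-comm 1 _ ⟩
            potential cs′ + 1    ≤⟨ ∑-mono-at _ _ w 1 0 off-w at-w ⟩
            potential cs + 0     ≡⟨ +-identityʳ _ ⟩
            potential cs         ∎

        -- If no neighbour of `v` has colour `k`, then `v` can take `k` without affecting any other
        -- vertex.
        colourable-or-neighboured : ∀ v k → Colourable S ⊎ (v ∈ S → 1 ≤ nbrs S (cs v) v k)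
        colourable-or-neighboured v k = decide (v ∈? S) (1 ≤? nbrs S (cs v) v k)
          where
          decide : Dec (v ∈ S) → Dec (1 ≤ nbrs S (cs v) v k) →
                   Colourable S ⊎ (v ∈ S → 1 ≤ nbrs S (cs v) v k)
          decide _         (yes 1≤s) = inj₂ λ _ → 1≤s
          decide (no v∉S)  (no _)    = inj₂ λ v∈S → contradiction v∈S v∉S
          decide (yes v∈S) (no 1≰s)  = inj₁ (extend (proper v v∈S)
            (≤-trans (≤-reflexive (n<1⇒n≡0 (≰⇒> 1≰s))) z≤n)
            λ u vu e → contradiction (#-some (nbr? S (cs v) v k) (vu , e)) 1≰s)

        progress-or-stable : ∀ v w → (Colourable S ⊎ Improvable cs) ⊎ Stable cs v w
        progress-or-stable v w
          with adj? S v w | nbrs S (cs v) v (cs v w) ℕ.≟ 1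
             | totalMono (S - w) (cs w) + cap (cs v w) ≤? totalMono (S - v) (cs v)
             | mono (S - v) (cs v) w <? cap (cs v w)
        ... | _      | _      | yes le | _     = inj₂ λ _ _ → le
        ... | no ¬vw | _      | no _   | _     = inj₂ λ vw _ → contradiction vw ¬vw
        ... | yes _  | no s≢1 | no _   | _     = inj₂ λ _ s≡1 → contradiction s≡1 s≢1
        -- Here `w` has room, so `v` takes its colour. A value below `cap (cs v w)` forces this
        -- capacity to be at least 1, which admits the single neighbour `w`.
        ... | yes vw | yes s≡1 | no _ | yes unsat = inj₁ (inj₁ (extend (proper v (proj₁ vw))
          (≤-trans (≤-reflexive s≡1) (≤-trans (s≤s z≤n) unsat))
          λ u vu e → subst (λ x → mono (S - v) (cs v) x < cap (cs v w))
            (#-unique (nbr? S (cs v) v (cs v w)) (≤-reflexive s≡1) (vw , refl) (vu , e)) unsat))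
        -- Here `w` is saturated, so the swapped colouring has total plus `cap (cs v w)` at most the
        -- total for `v`, which is less than the total for `w` plus the same capacity; cancelling it
        -- gives a strict improvement.
        ... | yes vw | yes s≡1 | no nle | no sat = inj₁ (inj₂ (replace-improves (proj₁ (proj₂ vw))
          (swap-Proper (proper v (proj₁ vw)) vw s≡1)
          (+-cancelʳ-< (cap (cs v w)) _ _ (≤-<-trans
            (swap-totalMono (proper v (proj₁ vw)) vw s≡1 (≮⇒≥ sat)) (≰⇒> nle)))))

      -- Discharging over a stable family.

      module _ (cs : Family)
               (neighboured : ∀ v k → v ∈ S → 1 ≤ nbrs S (cs v) v k)
               (stable : ∀ v w → Stable cs v w) where

        private
          s : V → Colour → ℕ
          s v k = nbrs S (cs v) v k

          claims : V → V → ℕ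
          claims v w = 𝟙 (adj? S v w) * claim (cs v w) (s v (cs v w))

          -- If v, w were each the other's only neighbour of its colour, stability in both directions
          -- would give F w < F v ≤ F w.
          claims-paid : ∀ v w → claims v w ≤ 𝟙 (adj? S w v) * payment (s w (cs w v))
          claims-paid v w with adj? S v w
          ... | no _   = z≤n
          ... | yes vw rewrite 𝟙-yes (adj? S w v) (Adj-sym vw) =
            +-monoˡ-≤ 0 (claim≤payment (cs v w) (s v (cs v w)) refl refl)
            where
            F = λ v → totalMono (S - v) (cs v)
            open ≤-Reasoning
            claim≤payment : ∀ k t → k ≡ cs v w → t ≡ s v (cs v w) →
                            claim k t ≤ payment (s w (cs w v))
            claim≤payment (inj₂ _) _             _ _ = z≤n
            claim≤payment (inj₁ _) 0             _ _ = z≤n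
            claim≤payment (inj₁ _) (suc (suc _)) _ _ = z≤n
            claim≤payment (inj₁ i) 1 k≡ t≡ with s w (cs w v) in eq
            -- Impossible: `v` itself is a neighbour of `w` with colour `cs w v`.
            ... | 0 = contradiction
              (subst (1 ≤_) eq (#-some (nbr? S (cs w) w (cs w v)) (Adj-sym vw , refl))) λ ()
            ... | suc (suc _) = ≤-refl
            ... | 1 = contradiction (begin-strict
                F w                    <⟨ ≤-reflexive (+-comm 1 _) ⟩
                F w + 1                ≡⟨ cong (λ k → F w + cap k) k≡ ⟩
                F w + cap (cs v w)     ≤⟨ stable v w vw (≡.sym t≡) ⟩
                F v                    ≤⟨ m≤m+n _ _ ⟩
                F v + cap (cs w v)     ≤⟨ stable w v (Adj-sym vw) eq ⟩
                F w                    ∎) (<-irrefl refl)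

          -- Claims on `v` are at most what `v` pays along its edges. Grouping its neighbours by
          -- their colour under `cs v` reduces the rest to `weight-balance` in each class, all of
          -- which are nonempty.
          balance-at : ∀ v → 𝟙 (v ∈? S) * (4 * a + 3 * b) + ∑ (λ w → claims w v) ≤
                             degree S v * 3 + ∑ (claims v)
          balance-at v = begin
            𝟙 (v ∈? S) * W + ∑ (λ w → claims w v)
              ≤⟨ +-monoʳ-≤ (𝟙 (v ∈? S) * W) (∑-mono _ _ λ w → claims-paid w v) ⟩
            𝟙 (v ∈? S) * W + ∑ (λ u → 𝟙 (adj? S v u) * payment (s v (cs v u)))
              ≤⟨ key ⟩
            ∑ (λ u → 𝟙 (adj? S v u) * (3 + claim (cs v u) (s v (cs v u))))
              ≡⟨ sum-cong-≗ (λ u → *-distribˡ-+ (𝟙 (adj? S v u)) 3 _) ⟩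
            ∑ (λ u → 𝟙 (adj? S v u) * 3 + claims v u)
              ≡⟨ ∑-distrib-+ (λ u → 𝟙 (adj? S v u) * 3) (claims v) ⟩
            ∑ (λ u → 𝟙 (adj? S v u) * 3) + ∑ (claims v)
              ≡⟨ cong (_+ ∑ (claims v)) (*-distribʳ-sum 3 (λ u → 𝟙 (adj? S v u))) ⟨
            degree S v * 3 + ∑ (claims v) ∎
            where
            open ≤-Reasoning
            W = 4 * a + 3 * b
            paid claimed : V → ℕ
            paid u = 𝟙 (adj? S v u) * payment (s v (cs v u))
            claimed u = 𝟙 (adj? S v u) * (3 + claim (cs v u) (s v (cs v u)))
            key : 𝟙 (v ∈? S) * W + ∑ paid ≤ ∑ claimed
            key = decide (v ∈? S)
              where
              decide : Dec (v ∈ S) → 𝟙 (v ∈? S) * W + ∑ paid ≤ ∑ claimed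
              decide (no v∉S) = subst (_≤ ∑ claimed) (≡.sym (cong₂ _+_
                (cong (_* W) (𝟙-no (v ∈? S) v∉S))
                (∑-zero paid λ u → cong (_* payment (s v (cs v u))) (𝟙-no (adj? S v u) (v∉S ∘ proj₁))))) z≤n
              decide (yes v∈S) = begin
                𝟙 (v ∈? S) * W + ∑ paid
                  ≡⟨ cong₂ _+_ (≡.trans (cong (_* W) (𝟙-yes (v ∈? S) v∈S)) (*-identityˡ W))
                               (∑-by-colour (adj? S v) (cs v) λ k → payment (s v k)) ⟩
                W + ∑ᶜ (λ k → s v k * payment (s v k))
                  ≡⟨ cong (_+ ∑ᶜ (λ k → s v k * payment (s v k))) ∑ᶜ-weight ⟨
                ∑ᶜ weight + ∑ᶜ (λ k → s v k * payment (s v k))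
                  ≡⟨ ∑ᶜ-distrib-+ weight (λ k → s v k * payment (s v k)) ⟨
                ∑ᶜ (λ k → weight k + s v k * payment (s v k))
                  ≤⟨ ∑ᶜ-mono _ _ (λ k → weight-balance k (neighboured v k v∈S)) ⟩
                ∑ᶜ (λ k → s v k * (3 + claim k (s v k)))
                  ≡⟨ ∑-by-colour (adj? S v) (cs v) (λ k → 3 + claim k (s v k)) ⟨
                ∑ claimed ∎

        -- Summed over all vertices, claims made and claims received are the same double sum, and
        -- cancel.
        dense : (4 * a + 3 * b) * # (_∈? S) ≤ 3 * ∑ (degree S)
        dense = subst₂ _≤_ (≡.trans (≡.sym (*-distribʳ-sum W (λ v → 𝟙 (v ∈? S)))) (*-comm _ W))
                           (≡.trans (≡.sym (*-distribʳ-sum 3 (degree S))) (*-comm (∑ (degree S)) 3))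
          (+-cancelʳ-≤ (∑ (λ v → ∑ (claims v))) _ _ (begin
            ∑ (λ v → 𝟙 (v ∈? S) * W) + ∑ (λ v → ∑ (claims v))
              ≡⟨ cong (∑ (λ v → 𝟙 (v ∈? S) * W) +_) (∑-comm claims) ⟩
            ∑ (λ v → 𝟙 (v ∈? S) * W) + ∑ (λ v → ∑ (λ w → claims w v))
              ≡⟨ ∑-distrib-+ (λ v → 𝟙 (v ∈? S) * W) (λ v → ∑ (λ w → claims w v)) ⟨
            ∑ (λ v → 𝟙 (v ∈? S) * W + ∑ (λ w → claims w v))
              ≤⟨ ∑-mono _ _ balance-at ⟩
            ∑ (λ v → degree S v * 3 + ∑ (claims v))
              ≡⟨ ∑-distrib-+ (λ v → degree S v * 3) (λ v → ∑ (claims v)) ⟩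
            ∑ (λ v → degree S v * 3) + ∑ (λ v → ∑ (claims v)) ∎))
          where
          open ≤-Reasoning
          W = 4 * a + 3 * b

      Dense : Set
      Dense = (4 * a + 3 * b) * # (_∈? S) ≤ 3 * ∑ (degree S)

      colourable-or-dense : ∀ cs → ProperFamily cs → Acc _<_ (potential cs) → Colourable S ⊎ Dense
      colourable-or-dense cs proper (acc rec)
        with everywhere (λ v → everywhere (progress-or-stable cs proper v))
      ... | inj₁ (inj₁ colouring) = inj₁ colouring
      ... | inj₁ (inj₂ (cs′ , proper′ , smaller)) = colourable-or-dense cs′ proper′ (rec smaller)
      ... | inj₂ stable
        with everywhere (λ v → everywhereᶜ (colourable-or-neighboured cs proper v))
      ...   | inj₁ colouring   = inj₁ colouring
      ...   | inj₂ neighboured = inj₂ (dense cs neighboured stable)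

    -- The density contradiction and induction on the vertex set.

    induced : Subset (n G) → Subgraph G
    induced S = record
      { vert  = λ u → ⌊ u ∈? S ⌋
      ; edge  = λ u v → ⌊ adj? S u v ⌋
      ; esym  = λ u v → ≡.trans (isYes≗does (adj? S u v)) (≡.trans
          (does-⇔ (mk⇔ Adj-sym Adj-sym) (adj? S u v) (adj? S v u)) (≡.sym (isYes≗does (adj? S v u))))
      ; eadj  = λ u v e → proj₂ (proj₂ (isYes⇒ (adj? S u v) e))
      ; evert = λ u v e → ⇒isYes (u ∈? S) (proj₁ (isYes⇒ (adj? S u v) e))
      }

    nV-induced : ∀ S → nV (induced S) ≡ # (_∈? S)
    nV-induced S = sum-allFin (λ u → 𝟙 (u ∈? S))

    twoE-induced : ∀ S → twoE (induced S) ≡ ∑ (degree S)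
    twoE-induced S = ≡.trans (sum-allFin (λ u → count (n G) (edge (induced S) u)))
      (sum-cong-≗ λ u → sum-allFin (λ v → 𝟙 (adj? S u v)))

    sparse⇒colourable : madLess G (4 * a + 3 * b) 3 → Colour → ∀ S → Acc _⊂_ S → Colourable S
    sparse⇒colourable sparse k₀ S (acc rec) = decide (nonempty? S)
      where
      family : ∀ v → ∃ λ c → v ∈ S → Proper (S - v) c
      family v with v ∈? S
      -- A default: nothing is required of the family at vertices outside `S`.
      ... | no v∉S  = const k₀ , λ v∈S → contradiction v∈S v∉S
      ... | yes v∈S = let (c , proper) = sparse⇒colourable sparse k₀ (S - v) (rec (x∈p⇒p-x⊂p v∈S))
                      in c , λ _ → proper
      open ≤-Reasoning
      decide : Dec (Nonempty S) → Colourable S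
      decide (no empty) = const k₀ , λ u →
        ≤-trans (≤-reflexive (#-none (nbr? S (const k₀) u k₀) λ v (uv , _) → empty (u , proj₁ uv))) z≤n
      decide (yes (v , v∈S)) =
        [ id , (λ dense → contradiction (begin-strict
            3 * twoE (induced S)                    <⟨ sparse (induced S)
              (subst (1 ≤_) (≡.sym (nV-induced S)) (#-some (_∈? S) v∈S)) ⟩
            (4 * a + 3 * b) * nV (induced S)        ≡⟨ cong ((4 * a + 3 * b) *_) (nV-induced S) ⟩
            (4 * a + 3 * b) * # (_∈? S)             ≤⟨ dense ⟩
            3 * ∑ (degree S)                        ≡⟨ cong (3 *_) (twoE-induced S) ⟨
            3 * twoE (induced S)                    ∎) (<-irrefl refl)) ]′
        (colourable-or-dense S (proj₁ ∘ family) (proj₂ ∘ family) (<-wellFounded _))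

    -- Passage to the stated form of colourability.

    colourable⇒Colorable : Colourable ⊤ → Colorable11-00 a b G
    colourable⇒Colorable (c , proper) = c , independent , defective
      where
      open ≤-Reasoning
      independent : ∀ u v (j : Fin b) → c u ≡ inj₂ j → c v ≡ inj₂ j → adj G u v ≡ false
      -- An edge inside this class would make `mono ⊤ c u` at least 1, above the capacity 0.
      independent u v j cu cv = Bool.¬-not λ uv → contradiction
        (≤-trans (#-some (nbr? ⊤ c u (c u)) ((∈⊤ , ∈⊤ , uv) , ≡.trans cu (≡.sym cv)))
          (subst (λ k → mono ⊤ c u ≤ cap k) cu (proper u)))
        λ ()
      defective : ∀ u (i : Fin a) → c u ≡ inj₁ i →
                  count (n G) (λ v → adj G u v ∧ ⌊ c v ≟ᶜ inj₁ i ⌋) ≤ 1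
      defective u i cu = begin
        count (n G) (λ v → adj G u v ∧ ⌊ c v ≟ᶜ inj₁ i ⌋)
          ≡⟨ sum-allFin (λ v → if adj G u v ∧ ⌊ c v ≟ᶜ inj₁ i ⌋ then 1 else 0) ⟩
        ∑ (λ v → if adj G u v ∧ ⌊ c v ≟ᶜ inj₁ i ⌋ then 1 else 0)
          ≤⟨ ∑-mono _ _ (λ v → if≤𝟙 _ (nbr? ⊤ c u (c u) v) λ t →
               (∈⊤ , ∈⊤ , ∧-true t) ,
               ≡.trans cu (≡.sym (isYes⇒ (c v ≟ᶜ inj₁ i) (∧-trueʳ {adj G u v} t)))) ⟩
        mono ⊤ c u    ≤⟨ proper u ⟩
        cap (c u)     ≤⟨ cap≤1 (c u) ⟩
        1             ∎
        where
        ∧-true : ∀ {x y} → x ∧ y ≡ true → x ≡ true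
        ∧-true {true} _ = refl
        ∧-trueʳ : ∀ {x y} → x ∧ y ≡ true → y ≡ true
        ∧-trueʳ {true} e = e

open Colouring

theorem1 : (a b : ℕ) → 1 ≤ a → (G : Graph) →
    madLess G (4 * a + 3 * b) 3 → Colorable11-00 a b G
theorem1 a b 1≤a G sparse =
  colourable⇒Colorable a b G
    -- The bound `1≤a` supplies the default colour.
    (sparse⇒colourable a b G sparse (inj₁ (fromℕ< 1≤a)) ⊤ (⊂-wellFounded ⊤))
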